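{- Let $\mathcal{H}$ be a set of graphs such that no graph in $\mathcal{H}$ contains a pair of vertices that are false twins. Then the class of $\mathcal{H}$-free atoms has bounded clique-width if and only if the class of $\mathcal{H}$-free graphs has bounded clique-width.
   Context: Graphs are finite, simple and undirected. A graph is $\mathcal{H}$-free if it contains no graph of $\mathcal{H}$ as an induced subgraph. Two (distinct) vertices of a graph are false twins if they have the same neighbourhood (so they are non-adjacent). A clique $K\subseteq V(G)$ (possibly empty) is a clique cut-set of $G$ if $G\setminus K$ is disconnected; an atom is a graph with no clique cut-set (so atoms are connected). The clique-width $\mathrm{cw}(G)$ is the minimum number of labels needed to construct $G$ using four operations: create a new graph consisting of a single vertex with label $i$; take the disjoint union of two labelled graphs; add an edge between every vertex with label $i$ and every vertex with label $j$ ($i\ne j$); relabel every vertex with label $i$ to have label $j$. A class of graphs has bounded clique-width if there is a constant $c$ with $\mathrm{cw}(G)\le c$ for every $G$ in the class; otherwise its clique-width is unbounded. -}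

module Defs where

open import Data.Nat using (ℕ; _≤_)
open import Data.Fin using (Fin; _≟_)
open import Data.Fin.Subset using (Subset; _∈_; _∉_)
open import Data.Product using (Σ-syntax; ∃-syntax; ∃₂; _×_)
open import Data.Sum using (_⊎_; inj₁; inj₂; [_,_]′)
open import Data.Unit using (⊤)
open import Data.Empty using (⊥)
open import Data.Bool using (if_then_else_)
open import Function.Bundles using (_⇔_; _↔_; Inverse)
open import Function.Definitions using (Injective)
open import Level using (0ℓ; _⊔_) renaming (suc to lsuc)
open import Relation.Binary.Core using (Rel)
open import Relation.Binary.Definitions using (Symmetric; Irreflexive; Decidable)
open import Relation.Binary.Construct.Closure.ReflexiveTransitive using (Star)
open import Relation.Binary.PropositionalEquality using (_≡_; _≢_)
open import Relation.Nullary using (¬_)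
open import Relation.Nullary.Decidable using (⌊_⌋)
open import Relation.Unary using (Pred)

record Graph : Set₁ where
  field
    order  : ℕ
    Adj    : Rel (Fin order) 0ℓ
    adj?   : Decidable Adj
    symm   : Symmetric Adj
    irrefl : Irreflexive _≡_ Adj

  Vertex : Set
  Vertex = Fin order

open Graph public

record _InducedIn_ (H G : Graph) : Set where
  field
    embed     : Vertex H → Vertex G
    injective : Injective _≡_ _≡_ embed
    induced   : ∀ u v → Adj H u v ⇔ Adj G (embed u) (embed v)

Free : ∀ {ℓ} → Pred Graph ℓ → Pred Graph (lsuc 0ℓ ⊔ ℓ)
Free ℋ G = ∀ H → ℋ H → ¬ (H InducedIn G)

FalseTwins : (G : Graph) → Rel (Vertex G) 0ℓ
FalseTwins G u v = u ≢ v × (∀ w → Adj G u w ⇔ Adj G v w)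

IsClique : (G : Graph) → Subset (order G) → Set
IsClique G K = ∀ u v → u ∈ K → v ∈ K → u ≢ v → Adj G u v

AdjOutside : (G : Graph) → Subset (order G) → Rel (Vertex G) 0ℓ
AdjOutside G K u v = u ∉ K × v ∉ K × Adj G u v

-- G ∖ K has two vertices not joined by a walk in G ∖ K.  In particular the
-- graph without vertices is not disconnected, so complete graphs are atoms.
DisconnectedOutside : (G : Graph) → Subset (order G) → Set
DisconnectedOutside G K =
  ∃₂ λ u v → u ∉ K × v ∉ K × ¬ Star (AdjOutside G K) u v

IsCliqueCutset : (G : Graph) → Subset (order G) → Set
IsCliqueCutset G K = IsClique G K × DisconnectedOutside G K

Atom : Pred Graph 0ℓ
Atom G = ¬ (∃[ K ] IsCliqueCutset G K)

data Expr (k : ℕ) : Set where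
  vertex  : Fin k → Expr k
  _⊕_     : Expr k → Expr k → Expr k
  join    : (i j : Fin k) → i ≢ j → Expr k → Expr k
  relabel : (i j : Fin k) → Expr k → Expr k

⟦_⟧V : ∀ {k} → Expr k → Set
⟦ vertex _ ⟧V      = ⊤
⟦ e ⊕ f ⟧V         = ⟦ e ⟧V ⊎ ⟦ f ⟧V
⟦ join _ _ _ e ⟧V  = ⟦ e ⟧V
⟦ relabel _ _ e ⟧V = ⟦ e ⟧V

label : ∀ {k} (e : Expr k) → ⟦ e ⟧V → Fin k
label (vertex i)      _ = i
label (e ⊕ f)           = [ label e , label f ]′
label (join _ _ _ e)    = label e
label (relabel i j e) v = if ⌊ label e v ≟ i ⌋ then j else label e v

⟦_⟧E : ∀ {k} (e : Expr k) → Rel ⟦ e ⟧V 0ℓ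
⟦ vertex _ ⟧E      _        _        = ⊥
⟦ e ⊕ f ⟧E         (inj₁ u) (inj₁ v) = ⟦ e ⟧E u v
⟦ e ⊕ f ⟧E         (inj₂ u) (inj₂ v) = ⟦ f ⟧E u v
⟦ e ⊕ f ⟧E         _        _        = ⊥
⟦ join i j _ e ⟧E  u        v        =
  ⟦ e ⟧E u v ⊎ (label e u ≡ i × label e v ≡ j) ⊎ (label e u ≡ j × label e v ≡ i)
⟦ relabel _ _ e ⟧E u        v        = ⟦ e ⟧E u v

record _Constructs_ {k} (e : Expr k) (G : Graph) : Set where
  field
    bijection : ⟦ e ⟧V ↔ Vertex G
    edges     : ∀ u v → ⟦ e ⟧E u v ⇔ Adj G (Inverse.to bijection u) (Inverse.to bijection v)

-- No expression denotes the graph without vertices; building it takes no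
-- operation, hence no label, so its clique-width is 0.
ConstructibleWith : ℕ → Graph → Set
ConstructibleWith k G = order G ≡ 0 ⊎ (Σ[ e ∈ Expr k ] e Constructs G)

IsMinimum : Pred ℕ 0ℓ → Pred ℕ 0ℓ
IsMinimum P k = P k × (∀ j → P j → k ≤ j)

IsCliqueWidth : Graph → ℕ → Set
IsCliqueWidth G = IsMinimum (λ k → ConstructibleWith k G)

BoundedCliqueWidth : ∀ {ℓ} → Pred Graph ℓ → Set (lsuc 0ℓ ⊔ ℓ)
BoundedCliqueWidth 𝒞 = ∃[ c ] (∀ G → 𝒞 G → ∀ k → IsCliqueWidth G k → k ≤ c)

{-# OPTIONS --safe #-}
-- If G is connected with at least two vertices, replace every vertex by two
-- false twins.  A clique misses one copy of each vertex, so no clique separates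
-- the result, which is therefore an atom; and an induced copy of a graph without
-- false twins cannot use both copies of a vertex, so the result is still ℋ-free.
-- As it contains G, its clique-width bounds that of G.  A disconnected graph is a
-- disjoint union of smaller ℋ-free graphs.
--
-- Constructively, clique-widths need not be computed: k ≤ suc c is stable under
-- double negation, so it suffices that the clique-width of the doubled graph
-- cannot fail to exist and that connectedness cannot fail to be decided.
-- The bound is suc c, since c may be 0 while a single vertex needs a label.
module Submission where

open import Level using (Level; 0ℓ)
open import Data.Fin using (Fin; zero; suc; _≟_; combine; quotient)
open import Data.Fin.Properties
  using (1↔⊤; +↔⊎; remQuot-combine; injective⇒≤; inject≤-injective; combine-injectiveʳ; ¬∀⟶∃¬; all?)
open import Data.Fin.Subset using (_∉_)
open import Data.Fin.Subset.Properties using (_∈?_)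
open import Data.Nat using (ℕ; zero; suc; _*_; _≤_; _<_; _≤?_; s≤s⁻¹)
open import Data.Nat.Induction using (<-rec)
open import Data.Nat.Properties using (≤-refl; ≤-trans; ≰⇒>; m≤n⇒m≤1+n)
open import Data.Product using (∃; ∃₂; ∃-syntax; Σ-syntax; _×_; _,_; proj₁; proj₂)
open import Data.Sum using (_⊎_; inj₁; inj₂; [_,_]′)
open import Data.Sum.Function.Propositional using (_⊎-↔_; _⊎-⇔_)
open import Data.Bool using (if_then_else_)
open import Data.Bool.Properties using (T-irrelevant)
open import Data.Unit using (⊤; tt)
open import Function using (_∘_; id)
open import Function.Bundles using (_⇔_; _↔_; Inverse; Equivalence; mk⇔; mk↔ₛ′)
open import Function.Definitions using (Injective)
open import Function.Properties.Inverse using (↔-sym; ↔-trans)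
open import Relation.Binary.Core using (Rel)
open import Relation.Binary.Construct.Closure.ReflexiveTransitive
  using (Star; ε; _◅_; _◅◅_; gmap; reverse)
open import Relation.Binary.PropositionalEquality
  using (_≡_; _≢_; refl; sym; trans; cong; subst; subst₂)
open import Relation.Binary.PropositionalEquality.WithK using (≡-irrelevant)
open import Relation.Nullary using (¬_; Dec; yes; no; contradiction; ¬?)
open import Relation.Nullary.Decidable
  using (True; ⌊_⌋; T?; toWitness; fromWitness;
         decidable-stable; ¬¬-excluded-middle)
open import Relation.Unary using (Pred; _∩_; Decidable; Irrelevant)
open import Defs

open Inverse using (to; from; strictlyInverseˡ; strictlyInverseʳ)
open Equivalence renaming (to to to⇔; from to from⇔) using ()
open _InducedIn_ using (embed; induced)
open _Constructs_

private
  variable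
    k k′ m n : ℕ
    ℓ : Level
    ℋ : Pred Graph ℓ

-- Finite subsets, counting and double negation

Finite : Set → Set
Finite A = ∃[ n ] (A ↔ Fin n)

⊤⊎↔Fin : ∀ {A : Set} → A ↔ Fin n → (⊤ ⊎ A) ↔ Fin (suc n)
⊤⊎↔Fin A↔n = ↔-trans (↔-sym 1↔⊤ ⊎-↔ A↔n) (↔-sym +↔⊎)

subset-finite : ∀ {P : Pred (Fin n) 0ℓ} → Decidable P → Irrelevant P → Finite (∃ P)
subset-finite {zero} _ _ = 0 , mk↔ₛ′ (λ ()) (λ ()) (λ ()) (λ ())
subset-finite {suc n} {P} P? irr with P? zero | subset-finite (P? ∘ suc) irr
... | yes p | m , ∃P↔m = suc m , ↔-trans split (⊤⊎↔Fin ∃P↔m)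
  where
  split : ∃ P ↔ (⊤ ⊎ ∃ (P ∘ suc))
  split = mk↔ₛ′
    (λ { (zero , _) → inj₁ tt ; (suc i , q) → inj₂ (i , q) })
    (λ { (inj₁ _) → zero , p ; (inj₂ (i , q)) → suc i , q })
    (λ { (inj₁ _) → refl ; (inj₂ _) → refl })
    (λ { (zero , q) → cong (zero ,_) (irr p q) ; (suc _ , _) → refl })
... | no ¬p | m , ∃P↔m = m , ↔-trans shift ∃P↔m
  where
  shift : ∃ P ↔ ∃ (P ∘ suc)
  shift = mk↔ₛ′
    (λ { (zero , q) → contradiction q ¬p ; (suc i , q) → i , q })
    (λ (i , q) → suc i , q)
    (λ _ → refl)
    (λ { (zero , q) → contradiction q ¬p ; (suc _ , _) → refl })

-- Sending one extra point to the missed value keeps the map injective.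
injective-nonsurjective⇒< : ∀ {f : Fin m → Fin n} → Injective _≡_ _≡_ f →
                            ∀ y → (∀ i → f i ≢ y) → m < n
injective-nonsurjective⇒< {m} {n} {f} f-inj y missed = injective⇒≤ {f = g} g-inj
  where
  g : Fin (suc m) → Fin n
  g zero    = y
  g (suc i) = f i

  g-inj : Injective _≡_ _≡_ g
  g-inj {zero}  {zero}  _  = refl
  g-inj {zero}  {suc j} eq = contradiction (sym eq) (missed j)
  g-inj {suc i} {zero}  eq = contradiction eq (missed i)
  g-inj {suc i} {suc j} eq = cong suc (f-inj eq)

-- Double negation shift, by induction over the finite index set.
¬¬-∀ : ∀ {P : Pred (Fin n) 0ℓ} → (∀ i → ¬ ¬ P i) → ¬ ¬ (∀ i → P i)
¬¬-∀ {zero}  _   ¬∀ = ¬∀ (λ ())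
¬¬-∀ {suc n} ¬¬P ¬∀ = ¬¬P zero λ p₀ → ¬¬-∀ (¬¬P ∘ suc) λ ps →
  ¬∀ λ { zero → p₀ ; (suc i) → ps i }

-- If there were no minimum, strong induction would refute `P` everywhere: a number satisfying `P`
-- with none below it would be one. `P` is not assumed decidable, hence the double negation.
¬¬∃IsMinimum : ∀ {P : Pred ℕ 0ℓ} {j} → P j → ¬ ¬ ∃ (IsMinimum P)
¬¬∃IsMinimum {P} Pj ¬min = <-rec (λ i → ¬ P i) step _ Pj
  where
  step : ∀ i → (∀ {j} → j < i → ¬ P j) → ¬ P i
  step i below Pi = ¬min (i , Pi , least)
    where
    least : ∀ j → P j → i ≤ j
    least j Pj = decidable-stable (i ≤? j) λ i≰j → below (≰⇒> i≰j) Pj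

-- Inflating the vertices of an expression

-- e′ arises from e by renaming labels along g and replacing each vertex v by an
-- independent set indexed by F v.
record IsInflation (e : Expr k) (g : Fin k → Fin k′) (F : ⟦ e ⟧V → Set)
                   (e′ : Expr k′) : Set where
  field
    vertices : ⟦ e′ ⟧V ↔ ∃ F

  base : ⟦ e′ ⟧V → ⟦ e ⟧V
  base = proj₁ ∘ to vertices

  field
    labels : ∀ u → label e′ u ≡ g (label e (base u))
    edges  : ∀ u v → ⟦ e′ ⟧E u v ⇔ ⟦ e ⟧E (base u) (base v)

open IsInflation

module _ (i : Fin k) where

  -- The parameter is one less than the number of vertices, since no expression is empty.
  coclique : ℕ → Expr k
  coclique zero    = vertex i
  coclique (suc n) = vertex i ⊕ coclique n

  coclique-vertices : ∀ n → ⟦ coclique n ⟧V ↔ Fin (suc n)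
  coclique-vertices zero    = ↔-sym 1↔⊤
  coclique-vertices (suc n) = ⊤⊎↔Fin (coclique-vertices n)

  coclique-labels : ∀ n u → label (coclique n) u ≡ i
  coclique-labels zero    _        = refl
  coclique-labels (suc n) (inj₁ _) = refl
  coclique-labels (suc n) (inj₂ u) = coclique-labels n u

  coclique-edgeless : ∀ n u v → ¬ ⟦ coclique n ⟧E u v
  coclique-edgeless (suc _) (inj₁ _) (inj₁ _) ()
  coclique-edgeless (suc _) (inj₁ _) (inj₂ _) ()
  coclique-edgeless (suc _) (inj₂ _) (inj₁ _) ()
  coclique-edgeless (suc n) (inj₂ u) (inj₂ v) = coclique-edgeless n u v

module _ {g : Fin k → Fin k′} (g-inj : Injective _≡_ _≡_ g) where

  private
    ≡⇔≡ : ∀ {a b i} → a ≡ g b → (a ≡ g i) ⇔ (b ≡ i)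
    ≡⇔≡ refl = mk⇔ g-inj (cong g)

    ×-⇔ : ∀ {A B C D : Set} → A ⇔ B → C ⇔ D → (A × C) ⇔ (B × D)
    ×-⇔ p q = mk⇔ (λ (a , c) → to⇔ p a , to⇔ q c) (λ (b , d) → from⇔ p b , from⇔ q d)

    relabel-natural : ∀ {a b} i j → a ≡ g b →
      (if ⌊ a ≟ g i ⌋ then g j else a) ≡ g (if ⌊ b ≟ i ⌋ then j else b)
    relabel-natural {b = b} i j refl with g b ≟ g i | b ≟ i
    ... | yes _  | yes _  = refl
    ... | yes eq | no b≢i = contradiction (g-inj eq) b≢i
    ... | no neq | yes eq = contradiction (cong g eq) neq
    ... | no _   | no _   = refl

    ∃-⊎ : ∀ {A B : Set} {F : A ⊎ B → Set} → (∃ (F ∘ inj₁) ⊎ ∃ (F ∘ inj₂)) ↔ ∃ F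
    ∃-⊎ = mk↔ₛ′
      [ (λ (a , x) → inj₁ a , x) , (λ (b , x) → inj₂ b , x) ]′
      (λ { (inj₁ a , x) → inj₁ (a , x) ; (inj₂ b , x) → inj₂ (b , x) })
      (λ { (inj₁ _ , _) → refl ; (inj₂ _ , _) → refl })
      (λ { (inj₁ _) → refl ; (inj₂ _) → refl })

    only-left : ∀ {A B : Set} {F : A ⊎ B → Set} → ¬ ∃ (F ∘ inj₂) → ∃ (F ∘ inj₁) ↔ ∃ F
    only-left {A} {B} {F} none = mk↔ₛ′ incl restrict incl-restrict (λ _ → refl)
      where
      incl : ∃ (F ∘ inj₁) → ∃ F
      incl (a , x) = inj₁ a , x

      restrict : ∃ F → ∃ (F ∘ inj₁)
      restrict (inj₁ a , x) = a , x
      restrict (inj₂ b , x) = contradiction (b , x) none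

      incl-restrict : ∀ y → incl (restrict y) ≡ y
      incl-restrict (inj₁ _ , _) = refl
      incl-restrict (inj₂ b , x) = contradiction (b , x) none

    only-right : ∀ {A B : Set} {F : A ⊎ B → Set} → ¬ ∃ (F ∘ inj₁) → ∃ (F ∘ inj₂) ↔ ∃ F
    only-right {A} {B} {F} none = mk↔ₛ′ incl restrict incl-restrict (λ _ → refl)
      where
      incl : ∃ (F ∘ inj₂) → ∃ F
      incl (b , x) = inj₂ b , x

      restrict : ∃ F → ∃ (F ∘ inj₂)
      restrict (inj₂ b , x) = b , x
      restrict (inj₁ a , x) = contradiction (a , x) none

      incl-restrict : ∀ y → incl (restrict y) ≡ y
      incl-restrict (inj₂ _ , _) = refl
      incl-restrict (inj₁ a , x) = contradiction (a , x) none

  -- An empty fibre deletes its vertex and a larger one multiplies it, so deletion and duplication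
  -- are handled at once. Vertices of one fibre share their label throughout, so they are treated
  -- alike by every `join`. Injectivity of `g` keeps joined labels distinct and makes label tests
  -- agree before and after renaming. The first alternative covers the case where nothing is left to
  -- denote.
  inflate : (e : Expr k) (F : ⟦ e ⟧V → Set) → (∀ v → Finite (F v)) →
            ¬ ∃ F ⊎ (∃[ e′ ] IsInflation e g F e′)
  inflate (vertex i) F fin with fin tt
  ... | zero  , F↔0 = inj₁ λ (_ , x) → contradiction (to F↔0 x) λ ()
  ... | suc n , F↔n = inj₂ (coclique (g i) n , record
    { vertices = ↔-trans (coclique-vertices (g i) n) (↔-trans (↔-sym F↔n)
                   (mk↔ₛ′ (tt ,_) proj₂ (λ _ → refl) (λ _ → refl)))
    ; labels   = coclique-labels (g i) n
    ; edges    = λ u v → mk⇔ (coclique-edgeless (g i) n u v) λ ()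
    })
  inflate (e ⊕ f) F fin
    with inflate e (F ∘ inj₁) (fin ∘ inj₁) | inflate f (F ∘ inj₂) (fin ∘ inj₂)
  ... | inj₁ none₁ | inj₁ none₂ = inj₁ λ
    { (inj₁ u , x) → none₁ (u , x) ; (inj₂ v , x) → none₂ (v , x) }
  ... | inj₁ none₁ | inj₂ (f′ , inf) = inj₂ (f′ , record
    { vertices = ↔-trans (vertices inf) (only-right none₁)
    ; labels = labels inf ; edges = edges inf })
  ... | inj₂ (e′ , inf) | inj₁ none₂ = inj₂ (e′ , record
    { vertices = ↔-trans (vertices inf) (only-left none₂)
    ; labels = labels inf ; edges = edges inf })
  ... | inj₂ (e′ , infₑ) | inj₂ (f′ , inf) = inj₂ (e′ ⊕ f′ , record
    { vertices = ↔-trans (vertices infₑ ⊎-↔ vertices inf) ∃-⊎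
    ; labels   = λ { (inj₁ u) → labels infₑ u ; (inj₂ v) → labels inf v }
    ; edges    = λ
      { (inj₁ u) (inj₁ v) → edges infₑ u v
      ; (inj₁ _) (inj₂ _) → mk⇔ id id
      ; (inj₂ _) (inj₁ _) → mk⇔ id id
      ; (inj₂ u) (inj₂ v) → edges inf u v }
    })
  inflate (join i j i≢j e) F fin with inflate e F fin
  ... | inj₁ none = inj₁ none
  ... | inj₂ (e′ , inf) = inj₂ (join (g i) (g j) (i≢j ∘ g-inj) e′ , record
    { vertices = vertices inf
    ; labels   = labels inf
    ; edges    = λ u v → edges inf u v ⊎-⇔
        (×-⇔ (≡⇔≡ (labels inf u)) (≡⇔≡ (labels inf v)) ⊎-⇔
         ×-⇔ (≡⇔≡ (labels inf u)) (≡⇔≡ (labels inf v)))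
    })
  inflate (relabel i j e) F fin with inflate e F fin
  ... | inj₁ none = inj₁ none
  ... | inj₂ (e′ , inf) = inj₂ (relabel (g i) (g j) e′ , record
    { vertices = vertices inf
    ; labels   = λ u → relabel-natural i j (labels inf u)
    ; edges    = edges inf
    })

-- Pulling graphs back along vertex maps

-- Strong homomorphisms that need not be injective: fibres are sets of false twins.
PullsBack : (H G : Graph) → (Vertex H → Vertex G) → Set
PullsBack H G π = ∀ u v → Adj H u v ⇔ Adj G (π u) (π v)

pull : (G : Graph) → (Fin m → Vertex G) → Graph
pull {m} G π = record
  { order  = m
  ; Adj    = λ u v → Adj G (π u) (π v)
  ; adj?   = λ u v → adj? G (π u) (π v)
  ; symm   = symm G
  ; irrefl = λ { refl → irrefl G refl }
  }

-- Inflate an expression for `G` by the fibres of `π`. This serves for the double of a graph, for a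
-- graph inside its double, and for induced parts; `k ≤ k′` allows spare labels.
constructible-pullsBack : ∀ {G H} {π : Vertex H → Vertex G} → PullsBack H G π → k ≤ k′ →
                          ConstructibleWith k G → ConstructibleWith k′ H
constructible-pullsBack {H = record { order = zero }} _ _ _ = inj₁ refl
constructible-pullsBack {G = record { order = zero }} {record { order = suc _ }} {π} _ _ _ =
  contradiction (π zero) λ ()
constructible-pullsBack {G = record { order = suc _ }} {record { order = suc _ }} _ _ (inj₁ ())
constructible-pullsBack {k = k} {k′} {G} {H@(record { order = suc _ })} {π} pb k≤k′ (inj₂ (e , con))
  with inflate (inject≤-injective k≤k′ k≤k′ _ _) e
         (λ v → Σ[ h ∈ Vertex H ] π h ≡ to (bijection con) v)
         (λ v → subset-finite (λ h → π h ≟ to (bijection con) v) ≡-irrelevant)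
... | inj₁ none = contradiction
  (from (bijection con) (π zero) , zero , sym (strictlyInverseˡ (bijection con) _)) none
... | inj₂ (e′ , inf) = inj₂ (e′ , record
  { bijection = ↔-trans (vertices inf) total
  ; edges     = λ u v → mk⇔
      (from⇔ (pb _ _) ∘ subst₂ (Adj G) (sym (over u)) (sym (over v))
        ∘ to⇔ (edges con _ _) ∘ to⇔ (edges inf u v))
      (from⇔ (edges inf u v) ∘ from⇔ (edges con _ _)
        ∘ subst₂ (Adj G) (over u) (over v) ∘ to⇔ (pb _ _))
  })
  where
  F : ⟦ e ⟧V → Set
  F v = Σ[ h ∈ Vertex H ] π h ≡ to (bijection con) v

  over : ∀ u → π (proj₁ (proj₂ (to (vertices inf) u))) ≡ to (bijection con) (base inf u)
  over u = proj₂ (proj₂ (to (vertices inf) u))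

  fibre-unique : ∀ {h v w} (p : π h ≡ to (bijection con) v) (q : π h ≡ to (bijection con) w) →
                 v ≡ w → _≡_ {A = ∃ F} (v , h , p) (w , h , q)
  fibre-unique {h} {v} p q refl = cong (λ r → v , h , r) (≡-irrelevant p q)

  -- Each vertex of `H` lies in exactly one fibre, because `bijection con` is a bijection and
  -- equality proofs in `Fin` are unique.
  total : ∃ F ↔ Vertex H
  total = mk↔ₛ′
    (λ (_ , h , _) → h)
    (λ h → from (bijection con) (π h) , h , sym (strictlyInverseˡ (bijection con) _))
    (λ _ → refl)
    (λ (v , h , p) → fibre-unique _ p
      (trans (cong (from (bijection con)) p) (strictlyInverseʳ (bijection con) v)))

TwinFree : Pred Graph ℓ → Set _
TwinFree ℋ = ∀ H → ℋ H → ¬ (∃₂ λ u v → FalseTwins H u v)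

-- Compose an embedding of `H` with `π`. Two vertices of `H` merged by the composite would have the
-- same neighbours in `H`, hence be false twins.
free-pullsBack : TwinFree ℋ → ∀ {G G′} {π : Vertex G′ → Vertex G} → PullsBack G′ G π →
                 Free ℋ G → Free ℋ G′
free-pullsBack twinFree {G} {G′} {π} pb free H H∈ℋ H⊆G′ = free H H∈ℋ record
  { embed = ρ ; injective = ρ-inj ; induced = ρ-pb }
  where
  ρ : Vertex H → Vertex G
  ρ = π ∘ embed H⊆G′

  ρ-pb : PullsBack H G ρ
  ρ-pb u v = mk⇔ (to⇔ (pb _ _) ∘ to⇔ (induced H⊆G′ u v))
                 (from⇔ (induced H⊆G′ u v) ∘ from⇔ (pb _ _))

  ρ-inj : Injective _≡_ _≡_ ρ
  ρ-inj {u} {v} ρu≡ρv = decidable-stable (u ≟ v) λ u≢v → twinFree H H∈ℋ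
    (u , v , u≢v , λ w → mk⇔
      (from⇔ (ρ-pb v w) ∘ subst (λ x → Adj G x (ρ w)) ρu≡ρv ∘ to⇔ (ρ-pb u w))
      (from⇔ (ρ-pb u w) ∘ subst (λ x → Adj G x (ρ w)) (sym ρu≡ρv) ∘ to⇔ (ρ-pb v w)))

pull-pullsBack : ∀ G (π : Fin m → Vertex G) → PullsBack (pull G π) G π
pull-pullsBack G π u v = mk⇔ id id

-- Doubling a connected graph

Connected : Pred Graph 0ℓ
Connected G = ∀ u v → Star (Adj G) u v

first-step : ∀ {A : Set} {R : Rel A 0ℓ} {u v} → Star R u v → u ≢ v → ∃ (R u)
first-step ε        u≢u = contradiction refl u≢u
first-step (uw ◅ _) _   = _ , uw

module _ (G : Graph) where

  original : Fin (order G * 2) → Vertex G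
  original = quotient {order G} 2

  double : Graph
  double = pull G original

  copy : Fin 2 → Vertex G → Vertex double
  copy i v = combine v i

  original-copy : ∀ i v → original (copy i v) ≡ v
  original-copy i v = cong proj₁ (remQuot-combine v i)

  copy-pullsBack : ∀ i → PullsBack G double (copy i)
  copy-pullsBack i u v = mk⇔
    (subst₂ (Adj G) (sym (original-copy i u)) (sym (original-copy i v)))
    (subst₂ (Adj G) (original-copy i u) (original-copy i v))

  -- Choosing a copy outside `K` for each vertex lifts every walk of `G` to one avoiding `K`. The
  -- given `x` and `y` need not be the chosen copies, so each is first linked to the chosen copy of
  -- a neighbour; a second vertex guarantees such a neighbour, even if `x` and `y` are copies of the
  -- same vertex.
  double-atom : Connected G → (∀ v → ∃ (v ≢_)) → Atom double
  double-atom connected another (K , K-clique , x , y , x∉K , y∉K , separated) =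
    separated (x→y (first-step (connected _ _) (proj₂ (another (original x))))
                   (first-step (connected _ _) (proj₂ (another (original y)))))
    where
    survivor : ∀ v → Σ[ x ∈ Vertex double ] original x ≡ v × x ∉ K
    survivor v with copy zero v ∈? K | copy (suc zero) v ∈? K
    ... | no ∉K  | _      = copy zero v , original-copy zero v , ∉K
    ... | yes _  | no ∉K  = copy (suc zero) v , original-copy (suc zero) v , ∉K
    -- The two copies of `v` are distinct but non-adjacent, so a clique cannot contain both.
    ... | yes ∈K | yes ∈K′ = contradiction
      (K-clique _ _ ∈K ∈K′ λ eq → 0≢1 (combine-injectiveʳ v zero v (suc zero) eq))
      (irrefl G (trans (original-copy zero v) (sym (original-copy (suc zero) v))))
      where
      0≢1 : _≢_ {A = Fin 2} zero (suc zero)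
      0≢1 ()

    edge : ∀ {x y} → x ∉ K → y ∉ K → ∀ {u v} → original x ≡ u → original y ≡ v →
           Adj G u v → AdjOutside double K x y
    edge x∉K y∉K refl refl uv = x∉K , y∉K , uv

    s : Vertex G → Vertex double
    s = proj₁ ∘ survivor

    original-s : ∀ v → original (s v) ≡ v
    original-s = proj₁ ∘ proj₂ ∘ survivor

    s∉K : ∀ v → s v ∉ K
    s∉K = proj₂ ∘ proj₂ ∘ survivor

    x→y : ∃ (Adj G (original x)) → ∃ (Adj G (original y)) → Star (AdjOutside double K) x y
    x→y (u , xu) (v , yv) =
      edge x∉K (s∉K u) refl (original-s u) xu ◅
      gmap s (edge (s∉K _) (s∉K _) (original-s _) (original-s _)) (connected u v) ◅◅
      edge (s∉K v) y∉K (original-s v) refl (symm G yv) ◅ ε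

-- Splitting the vertex set and disjoint unions

expression : ∀ {G} → Vertex G → ConstructibleWith k G → Σ[ e ∈ Expr k ] e Constructs G
expression {G = record { order = suc _ }} _ (inj₂ eG) = eG

-- With no edges between the parts, `⊕` rebuilds `G`. Both expressions draw on the same `k` labels,
-- so the union costs no new one.
constructible-⊕ : ∀ {G} {f : Fin m → Vertex G} {h : Fin n → Vertex G} →
  (parts : (Fin m ⊎ Fin n) ↔ Vertex G) →
  (∀ i → to parts (inj₁ i) ≡ f i) → (∀ j → to parts (inj₂ j) ≡ h j) →
  (∀ i j → ¬ Adj G (f i) (h j)) →
  Σ[ e ∈ Expr k ] e Constructs pull G f → Σ[ e ∈ Expr k ] e Constructs pull G h →
  ConstructibleWith k G
constructible-⊕ {G = G} {f} {h} parts is-f is-h apart (e , con) (e′ , con′) = inj₂ (e ⊕ e′ , record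
  { bijection = ↔-trans (bijection con ⊎-↔ bijection con′) parts
  ; edges     = λ
    { (inj₁ u) (inj₁ v) → mk⇔
        (subst₂ (Adj G) (sym (is-f _)) (sym (is-f _)) ∘ to⇔ (edges con u v))
        (from⇔ (edges con u v) ∘ subst₂ (Adj G) (is-f _) (is-f _))
    ; (inj₁ u) (inj₂ v) → mk⇔ (λ ()) (apart _ _ ∘ subst₂ (Adj G) (is-f _) (is-h _))
    ; (inj₂ u) (inj₁ v) → mk⇔ (λ ()) (apart _ _ ∘ symm G ∘ subst₂ (Adj G) (is-h _) (is-f _))
    ; (inj₂ u) (inj₂ v) → mk⇔
        (subst₂ (Adj G) (sym (is-h _)) (sym (is-h _)) ∘ to⇔ (edges con′ u v))
        (from⇔ (edges con′ u v) ∘ subst₂ (Adj G) (is-h _) (is-h _))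
    }
  })

record Listing (P : Pred (Fin n) 0ℓ) : Set where
  field
    size      : ℕ
    at        : Fin size → Fin n
    sound     : ∀ i → P (at i)
    injective : Injective _≡_ _≡_ at
    complete  : ∀ {v} → P v → ∃[ i ] at i ≡ v

open Listing

listing : ∀ {P : Pred (Fin n) 0ℓ} → Decidable P → Listing P
-- `P v` may have many proofs, as with walks, whereas `True (P? v)` has at most one; so each element
-- is listed once.
listing {n} {P} P? with subset-finite {P = λ v → True (P? v)} (λ _ → T? _) T-irrelevant
... | m , ∃P↔m = record
  { size      = m
  ; at        = proj₁ ∘ from ∃P↔m
  ; sound     = λ i → toWitness (proj₂ (from ∃P↔m i))
  ; injective = λ {i} {j} eq → trans (sym (strictlyInverseˡ ∃P↔m i))
      (trans (cong (to ∃P↔m) (unique (from ∃P↔m i) (from ∃P↔m j) eq)) (strictlyInverseˡ ∃P↔m j))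
  ; complete  = λ Pv → to ∃P↔m (_ , fromWitness Pv) ,
      cong proj₁ (strictlyInverseʳ ∃P↔m (_ , fromWitness Pv))
  }
  where
  unique : (p q : ∃ λ v → True (P? v)) → proj₁ p ≡ proj₁ q → p ≡ q
  unique (v , p) (_ , q) refl = cong (v ,_) (T-irrelevant p q)

missing⇒size< : ∀ {P : Pred (Fin n) 0ℓ} (L : Listing P) {v} → ¬ P v → size L < n
missing⇒size< {P = P} L {v} ¬Pv =
  injective-nonsurjective⇒< (injective L) v λ i eq → ¬Pv (subst P eq (sound L i))

partition : ∀ {P : Pred (Fin n) 0ℓ} → Decidable P → (L : Listing P) (M : Listing (¬_ ∘ P)) →
            (Fin (size L) ⊎ Fin (size M)) ↔ Fin n
partition {n} {P} P? L M = mk↔ₛ′ merge place merge-place place-merge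
  where
  merge : Fin (size L) ⊎ Fin (size M) → Fin n
  merge = [ at L , at M ]′

  place : Fin n → Fin (size L) ⊎ Fin (size M)
  place v with P? v
  ... | yes Pv = inj₁ (proj₁ (complete L Pv))
  ... | no ¬Pv = inj₂ (proj₁ (complete M ¬Pv))

  merge-place : ∀ v → merge (place v) ≡ v
  merge-place v with P? v
  ... | yes Pv = proj₂ (complete L Pv)
  ... | no ¬Pv = proj₂ (complete M ¬Pv)

  place-merge : ∀ x → place (merge x) ≡ x
  place-merge (inj₁ i) with P? (at L i)
  ... | yes Pv = cong inj₁ (injective L (proj₂ (complete L Pv)))
  ... | no ¬Pv = contradiction (sound L i) ¬Pv
  place-merge (inj₂ j) with P? (at M j)
  ... | yes Pv = contradiction Pv (sound M j)
  ... | no ¬Pv = cong inj₂ (injective M (proj₂ (complete M ¬Pv)))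

constructible-order1 : ∀ {G} → order G ≡ 1 → ConstructibleWith (suc k) G
constructible-order1 {G = G@(record { order = 1 })} refl = inj₂ (vertex zero , record
  { bijection = ↔-sym 1↔⊤
  ; edges     = λ _ _ → mk⇔ (λ ()) (irrefl G refl)
  })

another-vertex : (v : Fin (suc (suc n))) → ∃ (v ≢_)
another-vertex zero    = suc zero , λ ()
another-vertex (suc _) = zero , λ ()

-- From atoms to all graphs

module _ {ℋ : Pred Graph ℓ} (twinFree : TwinFree ℋ) {c : ℕ}
         (atoms≤c : ∀ G → (Free ℋ ∩ Atom) G → ∀ k → IsCliqueWidth G k → k ≤ c) where

  -- The expression with `k` labels shows that the double has some expression, hence, up to double
  -- negation, a clique-width `m`. As the double is an atom, `m ≤ c`, and restricting to one copy of
  -- each vertex returns to `G`.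
  constructible-connected : ∀ {G} → Connected G → (∀ v → ∃ (v ≢_)) → Free ℋ G →
                            ConstructibleWith k G → ¬ ¬ ConstructibleWith (suc c) G
  constructible-connected {G = G} connected another free con ¬con =
    ¬¬∃IsMinimum (constructible-pullsBack doubled ≤-refl con) λ (m , m-min) → ¬con
      (constructible-pullsBack (copy-pullsBack G zero)
        (m≤n⇒m≤1+n (atoms≤c (double G)
          (free-pullsBack twinFree doubled free , double-atom G connected another) m m-min))
        (proj₁ m-min))
    where
    doubled : PullsBack (double G) G (original G)
    doubled = pull-pullsBack G (original G)

  -- Induction on a bound for the order. The number `k` is unrelated to `c`; the parts of a
  -- disconnected graph inherit an expression with `k` labels by pulling back.
  constructible : ∀ n {G} → order G ≤ n → Free ℋ G →
                  ConstructibleWith k G → ¬ ¬ ConstructibleWith (suc c) G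
  constructible n {record { order = 0 }} _ _ _ ¬con = ¬con (inj₁ refl)
  -- A single vertex is treated apart: its double is two isolated vertices, which the empty clique
  -- separates.
  constructible n {record { order = 1 }} _ _ _ ¬con = ¬con (constructible-order1 refl)
  constructible {k} (suc n) {G@(record { order = suc (suc _) })} ≤n free con ¬con =
    ¬¬-∀ {P = λ v → Dec (Star (Adj G) zero v)} (λ _ → ¬¬-excluded-middle) split
    where
    split : ¬ Decidable (Star (Adj G) zero)
    split reach? with all? reach?
    ... | yes reach = constructible-connected
      (λ u v → reverse (symm G) (reach u) ◅◅ reach v) another-vertex free con ¬con
    -- The parts are the component of `zero` and its complement. The first misses `far` and the
    -- second misses `zero`, so both are smaller; these same vertices show that both are nonempty.
    ... | no ¬reach with ¬∀⟶∃¬ _ _ reach? ¬reach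
    ...   | far , ¬reach-far =
      part L (missing⇒size< L ¬reach-far) λ con₁ →
      part M (missing⇒size< M λ ¬reach → ¬reach ε) λ con₂ →
      ¬con (constructible-⊕ {f = at L} {h = at M} (partition reach? L M) (λ _ → refl) (λ _ → refl)
        -- An edge across would extend a walk from `zero` into the complement.
        (λ i j adj → sound M j (sound L i ◅◅ adj ◅ ε))
        (expression (proj₁ (complete L ε)) con₁)
        (expression (proj₁ (complete M ¬reach-far)) con₂))
      where
      L = listing reach?
      M = listing (¬? ∘ reach?)

      part : ∀ {P} (L : Listing P) → size L < order G → ¬ ¬ ConstructibleWith (suc c) (pull G (at L))
      part L size<order = constructible n (s≤s⁻¹ (≤-trans size<order ≤n))
        (free-pullsBack twinFree (pull-pullsBack G (at L)) free)
        (constructible-pullsBack (pull-pullsBack G (at L)) ≤-refl con)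

lemma13 : ∀ {ℓ : Level} (ℋ : Pred Graph ℓ) →
    (∀ H → ℋ H → ¬ (∃₂ λ u v → FalseTwins H u v)) →
    BoundedCliqueWidth (Free ℋ ∩ Atom) ⇔ BoundedCliqueWidth (Free ℋ)
lemma13 ℋ twinFree = mk⇔
  -- Minimality of `k` turns constructibility with `suc c` labels into `k ≤ suc c`, whose
  -- decidability removes the double negation.
  (λ (c , atoms≤c) → suc c , λ G free k (con , least) → decidable-stable (k ≤? suc c)
    λ k≰1+c → constructible twinFree atoms≤c (order G) ≤-refl free con (k≰1+c ∘ least (suc c)))
  (λ (c , all≤c) → c , λ G (free , _) → all≤c G free)
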